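{- Let $P_1,\ldots,P_n$ be countable meet-continuous dcpos. Suppose that, for each $i$ and each $r\in P_i$, every nonempty subset of $\mathord{\downarrow}r$ has a supremum in $\mathord{\downarrow}r$. Then \[ \sigma\Bigl(\prod_{i=1}^{n}P_i\Bigr)=\prod_{i=1}^{n}\sigma(P_i). \] Neither global least elements nor least elements of the principal ideals are required.
   Context: All posets and directed sets are nonempty; countable sets may be finite. A subset $D$ of a poset is directed if any two of its elements have a common upper bound in $D$. A dcpo is a poset in which every directed subset has a supremum. Write $\mathord{\downarrow}x=\{y:y\le x\}$ (a principal ideal) and $\mathord{\downarrow}A=\bigcup_{a\in A}\mathord{\downarrow}a$. A supremum in $\mathord{\downarrow}r$ means a least upper bound computed in the poset $\mathord{\downarrow}r$ with its induced order. For a dcpo $P$, an upper set $U\subseteq P$ is Scott open if for every directed $D\subseteq P$, $\bigvee D\in U$ implies $D\cap U\neq\emptyset$; the Scott open sets form the Scott topology $\sigma(P)$. A dcpo $P$ is meet-continuous if for every $x\in P$ and every directed $D\subseteq P$, $x\le\bigvee D$ implies $x\in\operatorname{cl}_{\sigma(P)}(\mathord{\downarrow}x\cap\mathord{\downarrow}D)$, where $\operatorname{cl}_{\sigma(P)}$ is closure in the Scott topology. $\prod_i P_i$ carries the coordinatewise order, $\sigma(\prod_i P_i)$ is its Scott topology, and $\prod_i\sigma(P_i)$ denotes the ordinary topological product of the Scott topologies. -}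

module Defs where

open import Data.Fin.Base using (Fin)
open import Data.Nat.Base using (ℕ)
open import Data.Product.Base using (_×_; ∃-syntax; proj₁; Σ-syntax)
open import Function.Bundles using (Injection)
open import Level using (Level; _⊔_; suc)
open import Relation.Binary.Bundles using (Poset)
open import Relation.Binary.Definitions using (_Respects_)
import Relation.Binary.Construct.On as On
open import Relation.Binary.Indexed.Homogeneous using (IndexedPoset)
import Relation.Binary.PropositionalEquality as ≡
open import Relation.Unary using (Pred; _∈_; _⊆_; _∩_; _≬_; ∁; Satisfiable)

private
  variable
    a c ℓ ℓ₁ ℓ₂ ℓ′ m : Level

-- A topology on X is represented by its family of open sets, a predicate
-- on the subsets `Pred X ℓ`.

module _ {X : Set a} where

  Closed : Pred (Pred X ℓ) m → Pred X ℓ → Set m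
  Closed 𝒯 C = ∁ C ∈ 𝒯

  cl : Pred (Pred X ℓ) m → Pred X ℓ′ → Pred X (a ⊔ suc ℓ ⊔ m ⊔ ℓ′)
  cl 𝒯 A x = ∀ C → Closed 𝒯 C → A ⊆ C → x ∈ C

-- The index set is finite, so all open boxes are basic open sets.

Box : ∀ {n} {X : Fin n → Set a} → (∀ i → Pred (X i) ℓ) → Pred (∀ i → X i) ℓ
Box V x = ∀ i → x i ∈ V i

ΠTop : ∀ {n} {X : Fin n → Set a} → (∀ i → Pred (Pred (X i) ℓ) m) →
       Pred (Pred (∀ i → X i) ℓ) (a ⊔ suc ℓ ⊔ m)
ΠTop {ℓ = ℓ} {X = X} 𝒯 U =
  ∀ x → x ∈ U →
  Σ[ V ∈ (∀ i → Pred (X i) ℓ) ] (∀ i → V i ∈ 𝒯 i) × x ∈ Box V × Box V ⊆ U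

module _ (P : Poset c ℓ₁ ℓ₂) where

  open Poset P

  ↓ : Carrier → Pred Carrier ℓ₂
  ↓ x y = y ≤ x

  ↓ˢ : Pred Carrier ℓ → Pred Carrier (c ⊔ ℓ₂ ⊔ ℓ)
  ↓ˢ A y = ∃[ x ] x ∈ A × y ∈ ↓ x

  ↓Poset : Carrier → Poset (c ⊔ ℓ₂) ℓ₁ ℓ₂
  ↓Poset r = On.poset {B = Σ[ y ∈ Carrier ] y ∈ ↓ r} P proj₁

  UpperBound : Pred Carrier ℓ → Pred Carrier (c ⊔ ℓ₂ ⊔ ℓ)
  UpperBound A u = ∀ x → x ∈ A → x ≤ u

  IsSup : Pred Carrier ℓ → Pred Carrier (c ⊔ ℓ₂ ⊔ ℓ)
  IsSup A s = s ∈ UpperBound A × (∀ u → u ∈ UpperBound A → s ≤ u)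

  Directed : Pred Carrier ℓ → Set (c ⊔ ℓ₂ ⊔ ℓ)
  Directed D =
    Satisfiable D ×
    (∀ x y → x ∈ D → y ∈ D → ∃[ z ] z ∈ D × x ≤ z × y ≤ z)

  -- Equality of elements is the setoid equality of the poset.

  Countable : Set (c ⊔ ℓ₁)
  Countable = Injection Eq.setoid (≡.setoid ℕ)

  -- ℓ is the universe level of the subsets under consideration.

  record IsDCPO (ℓ : Level) : Set (c ⊔ ℓ₂ ⊔ suc ℓ) where
    field
      nonempty    : Carrier
      directedSup : ∀ (D : Pred Carrier ℓ) → Directed D → ∃[ s ] s ∈ IsSup D

  -- Suprema enter relationally, so σ makes sense for any poset.

  σ : ∀ ℓ → Pred (Pred Carrier ℓ) (c ⊔ ℓ₂ ⊔ suc ℓ)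
  σ ℓ U =
    U Respects _≤_ ×
    (∀ (D : Pred Carrier ℓ) → Directed D → ∀ s → s ∈ IsSup D → s ∈ U → D ≬ U)

  MeetContinuous : ∀ ℓ → Set (c ⊔ ℓ₂ ⊔ suc ℓ)
  MeetContinuous ℓ =
    ∀ x (D : Pred Carrier ℓ) → Directed D → ∀ s → s ∈ IsSup D →
    x ≤ s → x ∈ cl (σ ℓ) (↓ x ∩ ↓ˢ D)

PrincipalIdealsHaveSups : Poset c ℓ₁ ℓ₂ → ∀ ℓ → Set (c ⊔ ℓ₂ ⊔ suc ℓ)
PrincipalIdealsHaveSups P ℓ =
  ∀ r (A : Pred (Poset.Carrier (↓Poset P r)) ℓ) →
  Satisfiable A → ∃[ s ] s ∈ IsSup (↓Poset P r) A

ΠPoset : ∀ {n} → (Fin n → Poset c ℓ₁ ℓ₂) → Poset c ℓ₁ ℓ₂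
ΠPoset P = IndexedPoset.poset record
  { Carrierᵢ        = λ i → Poset.Carrier (P i)
  ; _≈ᵢ_            = λ {i} → Poset._≈_ (P i)
  ; _≤ᵢ_            = λ {i} → Poset._≤_ (P i)
  ; isPartialOrderᵢ = record
    { isPreorderᵢ = record
      { isEquivalenceᵢ = record
        { reflᵢ  = λ {i} → Poset.Eq.refl (P i)
        ; symᵢ   = λ {i} → Poset.Eq.sym (P i)
        ; transᵢ = λ {i} → Poset.Eq.trans (P i)
        }
      ; reflexiveᵢ = λ {i} → Poset.reflexive (P i)
      ; transᵢ     = λ {i} → Poset.trans (P i)
      }
    ; antisymᵢ = λ {i} → Poset.antisym (P i)
    }
  }

{-# OPTIONS --safe #-}
module Submission where

-- The inclusion ⊇ is routine.  For ⊆, let x ∈ U with U Scott open in the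
-- product.  Inside U one chooses a descending sequence x = p₀ ≥ p₁ ≥ … such
-- that in each factor the filter Fᵢ generated by the i-th coordinates is Scott
-- open; the box of the Fᵢ then lies in U.
--
-- A filter F fails to be Scott open at a directed set I when ⋁ I ∈ F but I
-- misses F.  Meet-continuity lets pₖ be lowered, within U, below a member of any
-- prescribed I with ⋁ I ≥ pₖ, so countably many I can be treated.  Countability
-- makes countably many I suffice.  Otherwise there is a nonempty family of pairs
-- a ≰ b such that every pair (a , b) in it admits x ≥ a′ , b with a′ ≤ a for
-- which (a′ , b) and (a , x) are again in the family.  A suitable branch of the
-- resulting binary tree has a supremum that differs from every element of a
-- given enumeration.

open import Defs
open import Axiom.ExcludedMiddle using (ExcludedMiddle)
open import Data.Empty using (⊥; ⊥-elim)
open import Data.Fin.Base as Fin using (Fin)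
import Data.Fin.Properties as Fin
open import Data.Nat.Base as ℕ using (ℕ; _≤′_; ≤′-refl; ≤′-step)
import Data.Nat.Properties as ℕ
open import Data.Product.Base
  using (_×_; _,_; proj₁; proj₂; Σ-syntax; ∃-syntax)
open import Function.Base using (_∘_; flip)
open import Function.Bundles using (Injection)
open import Level using (Level; Lift; lift; lower; _⊔_; suc)
open import Relation.Binary.Bundles using (Poset)
open import Relation.Binary.Core using (Rel)
open import Relation.Binary.Definitions
  using (Reflexive; Transitive; _Respects_; tri<; tri≈; tri>)
open import Relation.Binary.PropositionalEquality
  using (_≡_; refl; sym; trans; cong; subst)
open import Relation.Nullary.Decidable
  using (Dec; yes; no; True; toWitness; fromWitness; decidable-stable)
open import Relation.Nullary.Negation using (¬_)
open import Relation.Unary using (Pred; _∈_; _⊆_; _≬_; Satisfiable; _≐_)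

-- Enumeration of pairs of natural numbers.

unpair : ℕ → ℕ × ℕ
unpair ℕ.zero = 0 , 0
unpair (ℕ.suc k) with unpair k
... | m , ℕ.zero  = 0 , ℕ.suc m
... | m , ℕ.suc n = ℕ.suc m , n

unpair-surjective : ∀ m n → ∃[ k ] unpair k ≡ (m , n)
unpair-surjective m n = onDiagonal (m ℕ.+ n) m n refl
  where
  -- The enumeration runs through antidiagonal s from `(0 , s)` to `(s , 0)`.
  onDiagonal : ∀ s m n → m ℕ.+ n ≡ s → ∃[ k ] unpair k ≡ (m , n)
  onDiagonal ℕ.zero ℕ.zero ℕ.zero _ = 0 , refl
  onDiagonal (ℕ.suc s) ℕ.zero (ℕ.suc .s) refl
    with k , eq ← onDiagonal s s 0 (ℕ.+-identityʳ s)
    = ℕ.suc k , next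
    where
    next : unpair (ℕ.suc k) ≡ (0 , ℕ.suc s)
    next rewrite eq = refl
  onDiagonal s (ℕ.suc m) n m+n≡s
    with k , eq ← onDiagonal s m (ℕ.suc n) (trans (ℕ.+-suc m n) m+n≡s)
    = ℕ.suc k , next
    where
    next : unpair (ℕ.suc k) ≡ (ℕ.suc m , n)
    next rewrite eq = refl

-- Ensures that a stage coding `(k , m)` comes no earlier than stage m.
unpair-sum-≤ : ∀ k → proj₁ (unpair k) ℕ.+ proj₂ (unpair k) ℕ.≤ k
unpair-sum-≤ ℕ.zero = ℕ.z≤n
unpair-sum-≤ (ℕ.suc k) with unpair k | unpair-sum-≤ k
... | m , ℕ.zero  | m+0≤k =
  ℕ.s≤s (ℕ.≤-trans (ℕ.≤-reflexive (sym (ℕ.+-identityʳ m))) m+0≤k)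
... | m , ℕ.suc n | m+n≤k =
  ℕ.≤-trans (ℕ.≤-reflexive (sym (ℕ.+-suc m n))) (ℕ.m≤n⇒m≤1+n m+n≤k)

steps⇒monotone : ∀ {a r} {A : Set a} {R : Rel A r} → Reflexive R → Transitive R →
                 (f : ℕ → A) → (∀ k → R (f k) (f (ℕ.suc k))) →
                 ∀ {m n} → m ≤′ n → R (f m) (f n)
steps⇒monotone rfl _   f step ≤′-refl       = rfl
steps⇒monotone {R = R} rfl tr f step (≤′-step m≤n) =
  tr (steps⇒monotone {R = R} rfl tr f step m≤n) (step _)

module _ {n : ℕ} {a : Level} {A : Fin n → Set a} where

  _[_≔_] : (∀ i → A i) → ∀ i → A i → ∀ j → A j
  (f [ i ≔ x ]) j with i Fin.≟ j
  ... | yes refl = x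
  ... | no  _    = f j

  ≔-elim : ∀ {p} (C : ∀ j → A j → Set p) (f : ∀ i → A i) i {x} →
           C i x → (∀ j → C j (f j)) → ∀ j → C j ((f [ i ≔ x ]) j)
  ≔-elim C f i cx cf j with i Fin.≟ j
  ... | yes refl = cx
  ... | no  _    = cf j

  ≔-diagonal : ∀ {p} (f : ∀ i → A i) i {x} (C : A i → Set p) →
               C ((f [ i ≔ x ]) i) → C x
  ≔-diagonal f i C c with i Fin.≟ i
  ... | yes refl = c
  ... | no  i≢i  = ⊥-elim (i≢i refl)

-- Directed sets, filters and failures of Scott openness.

module _ {c ℓ₁ ℓ₂ ℓ : Level} (P : Poset c ℓ₁ ℓ₂) where

  open Poset P

  directed⇒finiteBound : ∀ {D : Pred Carrier ℓ} → Directed P D →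
    ∀ {n} (f : Fin n → Carrier) → (∀ i → f i ∈ D) →
    ∃[ u ] u ∈ D × (∀ i → f i ≤ u)
  directed⇒finiteBound ((d , d∈D) , _) {ℕ.zero} f f∈D = d , d∈D , λ ()
  directed⇒finiteBound dir@(_ , join) {ℕ.suc n} f f∈D
    with u , u∈D , f≤u ← directed⇒finiteBound dir (f ∘ Fin.suc) (f∈D ∘ Fin.suc)
    with v , v∈D , f₀≤v , u≤v ← join _ _ (f∈D Fin.zero) u∈D
    = v , v∈D , λ { Fin.zero → f₀≤v ; (Fin.suc i) → Poset.trans P (f≤u i) u≤v }

  record IsFilter (F : Pred Carrier ℓ) : Set (c ⊔ ℓ₂ ⊔ ℓ) where
    field
      upper : F Respects _≤_
      down  : ∀ x y → x ∈ F → y ∈ F → ∃[ z ] z ∈ F × z ≤ x × z ≤ y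

  Dominates : Pred Carrier ℓ → Carrier → Set (c ⊔ ℓ₂ ⊔ ℓ)
  Dominates J p = Directed P J × ∃[ s ] IsSup P J s × p ≤ s

  -- The bound r confines I to one principal ideal, where the suprema along a branch can be formed.
  Defect : Carrier → Pred Carrier ℓ → Pred Carrier ℓ → Set (c ⊔ ℓ₂ ⊔ ℓ)
  Defect r F I = IsFilter F × Directed P I × (∃[ s ] IsSup P I s × s ∈ F) ×
                 I ⊆ ↓ P r × ¬ (I ≬ F)

module _ (em : ∀ a → ExcludedMiddle a) where

  dne : ∀ {a} {A : Set a} → ¬ ¬ A → A
  dne = decidable-stable (em _)

  -- Under excluded middle every predicate has a logically equivalent copy at
  -- the level ℓ at which the dcpos are assumed complete.
  Resize : ∀ {a} ℓ → Set a → Set ℓ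
  Resize ℓ A = Lift ℓ (True (em _ {A}))

  resize : ∀ {a ℓ} {A : Set a} → A → Resize ℓ A
  resize = lift ∘ fromWitness

  unresize : ∀ {a ℓ} {A : Set a} → Resize ℓ A → A
  unresize = toWitness ∘ lower

  -- Meet-continuity in a single factor.

  module Factor {c ℓ₁ ℓ₂ : Level} (ℓ : Level) (P : Poset c ℓ₁ ℓ₂) where

    open Poset P renaming (refl to ≤-refl; trans to ≤-trans)

    below : Carrier → Pred Carrier ℓ → Pred Carrier ℓ
    below p D y = Resize ℓ (y ≤ p × y ∈ ↓ˢ P D)

    module _ (mc : MeetContinuous P ℓ) (sups : PrincipalIdealsHaveSups P ℓ) where

      -- For an upper bound u, the set of all y ≤ u is Scott closed and contains every element of
      -- the down-set of D below p, so meet-continuity puts p in it.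
      below-isSup : ∀ {D s p} → Directed P D → IsSup P D s → p ≤ s →
                    IsSup P (below p D) p
      below-isSup {D} {s} {p} dir sup p≤s = (λ _ → proj₁ ∘ unresize) , least
        where
        least : ∀ u → u ∈ UpperBound P (below p D) → p ≤ u
        least u ub = unresize (mc p D dir s sup p≤s (λ y → Resize ℓ (y ≤ u))
          ( (λ x≤y ¬x≤u y≤u → ¬x≤u (resize (≤-trans x≤y (unresize y≤u))))
          , λ E _ t t-sup ¬t≤u → dne λ ¬meets → ¬t≤u (resize (proj₂ t-sup u
              λ x x∈E → dne λ ¬x≤u → ¬meets (x , x∈E , ¬x≤u ∘ unresize))))
          (λ y∈ → resize (ub _ (resize y∈))))

      below-directed : ∀ {D s p} → Directed P D → IsSup P D s → p ≤ s →
                       Directed P (below p D)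
      below-directed {D} {s} {p} dir@((d₀ , d₀∈D) , bound) sup p≤s =
        inhabited , join
        where
        inhabited : Satisfiable (below p D)
        -- Were the set empty, d₀ would bound it vacuously; then p ≤ d₀ and p would belong to it.
        inhabited = dne λ empty → empty (p , resize (≤-refl , d₀ , d₀∈D ,
          proj₂ (below-isSup dir sup p≤s) d₀ λ x x∈ → ⊥-elim (empty (x , x∈))))

        join : ∀ x y → x ∈ below p D → y ∈ below p D →
               ∃[ z ] z ∈ below p D × x ≤ z × y ≤ z
        join x y x∈ y∈
          with x≤p , d₁ , d₁∈D , x≤d₁ ← unresize x∈
             | y≤p , d₂ , d₂∈D , y≤d₂ ← unresize y∈
          with d , d∈D , d₁≤d , d₂≤d ← bound _ _ d₁∈D d₂∈D
          -- The join of all common lower bounds of p and d is their meet. It is formed below s, and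
          -- x shows that there is such a bound.
          with (z , z≤s) , z-upper , z-least ← sups s
                 (λ w → Resize ℓ (proj₁ w ≤ p × proj₁ w ≤ d))
                 ((x , ≤-trans x≤p p≤s) , resize (x≤p , ≤-trans x≤d₁ d₁≤d))
          = z
          , resize ( z-least (p , p≤s) (λ _ → proj₁ ∘ unresize)
                   , d , d∈D
                   , z-least (d , proj₁ sup d d∈D) (λ _ → proj₂ ∘ unresize))
          , z-upper (x , ≤-trans x≤p p≤s) (resize (x≤p , ≤-trans x≤d₁ d₁≤d))
          , z-upper (y , ≤-trans y≤p p≤s) (resize (y≤p , ≤-trans y≤d₂ d₂≤d))

      -- The principal ideal of p is the default when J does not dominate p, so that every
      -- coordinate supplies a directed set with supremum p.
      refine : ∀ (J : Pred Carrier ℓ) p → Σ[ E ∈ Pred Carrier ℓ ]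
        Directed P E × IsSup P E p × (Dominates P J p → E ⊆ ↓ˢ P J)
      refine J p with em _ {Dominates P J p}
      ... | yes (dir , s , sup , p≤s) =
        below p J , below-directed dir sup p≤s , below-isSup dir sup p≤s ,
        λ _ → proj₂ ∘ unresize
      ... | no ¬dom =
        (λ y → Resize ℓ (y ≤ p)) ,
        ((p , resize ≤-refl) ,
         λ x y x≤p y≤p → p , resize ≤-refl , unresize x≤p , unresize y≤p) ,
        ((λ _ → unresize) , λ u ub → ub p (resize ≤-refl)) ,
        ⊥-elim ∘ ¬dom

    -- Detecting all defects by countably many directed sets.

    module _ (countable : Countable P) (sups : PrincipalIdealsHaveSups P ℓ)
             (r : Carrier) where

      open Injection countable using (injective) renaming (to to code)

      code-≤ : ∀ {x y} → code x ≡ code y → x ≤ y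
      code-≤ = reflexive ∘ injective

      -- A branch is steered at level k so that its supremum t differs from the
      -- element coded by k: going up keeps t ≰ z, going down keeps t ≤ z,
      -- where z = bot (hi (hi ν)).
      noSplittingTree : ∀ {v} {N : Set v} (top bot : N → Carrier) (lo hi : N → N) →
        (∀ ν → ¬ top ν ≤ bot ν) →
        (∀ ν → top (lo ν) ≤ top ν) → (∀ ν → top (hi ν) ≤ top ν) →
        (∀ ν → bot ν ≤ bot (lo ν)) → (∀ ν → bot ν ≤ bot (hi ν)) →
        (∀ ν → top (lo ν) ≤ bot (hi ν)) → (∀ ν → bot (hi ν) ≤ r) →
        ¬ N
      noSplittingTree {N = N} top bot lo hi top≰bot lo-top hi-top lo-bot hi-bot
                      lo≤hi hi≤r root = absurd
        where
        Caught : ℕ → N → Set _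
        Caught k ν = ∃[ w ] code w ≡ k × w ≤ bot (hi (hi ν))

        -- Both turns pass through `hi ν`, whose bottom bounds the piece `top (lo ν)`; the choice is
        -- between its two children.
        turn : ∀ {k ν} → Dec (Caught k ν) → N
        turn {ν = ν} (yes _) = hi (hi ν)
        turn {ν = ν} (no  _) = lo (hi ν)

        node : ℕ → N
        node ℕ.zero    = root
        node (ℕ.suc k) = turn (em _ {Caught k (node k)})

        turn-top : ∀ {k ν} (d : Dec (Caught k ν)) → top (turn d) ≤ top ν
        turn-top (yes _) = ≤-trans (hi-top _) (hi-top _)
        turn-top (no  _) = ≤-trans (lo-top _) (hi-top _)

        turn-bot : ∀ {k ν} (d : Dec (Caught k ν)) → bot (hi ν) ≤ bot (turn d)
        turn-bot (yes _) = hi-bot _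
        turn-bot (no  _) = lo-bot _

        top-antitone : ∀ {m n} → m ≤′ n → top (node n) ≤ top (node m)
        top-antitone = steps⇒monotone {R = flip _≤_} ≤-refl (flip ≤-trans)
          (top ∘ node) (λ _ → turn-top (em _))

        bot-monotone : ∀ {m n} → m ≤′ n → bot (node m) ≤ bot (node n)
        bot-monotone = steps⇒monotone {R = _≤_} ≤-refl ≤-trans
          (bot ∘ node) (λ _ → ≤-trans (hi-bot _) (turn-bot (em _)))

        piece≤r : ∀ k → top (lo (node k)) ≤ r
        piece≤r k = ≤-trans (lo≤hi _) (hi≤r _)

        supremum = sups r (λ w → Resize ℓ (∃[ k ] proj₁ w ≡ top (lo (node k))))
          ((top (lo root) , piece≤r 0) , resize (0 , refl))

        t : Carrier
        t = proj₁ (proj₁ supremum)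

        piece≤t : ∀ k → top (lo (node k)) ≤ t
        piece≤t k = proj₁ (proj₂ supremum) (_ , piece≤r k) (resize (k , refl))

        n = code t
        z = bot (hi (hi (node n)))

        pieces≤z : top (node (ℕ.suc n)) ≤ z → ∀ k → top (lo (node k)) ≤ z
        pieces≤z next≤z k with ℕ.<-cmp k n
        ... | tri< k<n _ _ = ≤-trans (lo≤hi _) (≤-trans (turn-bot (em _))
          (≤-trans (bot-monotone (ℕ.≤⇒≤′ k<n)) (≤-trans (hi-bot _) (hi-bot _))))
        ... | tri≈ _ refl _ = ≤-trans (lo≤hi _) (hi-bot _)
        ... | tri> _ _ n<k = ≤-trans (lo-top _)
          (≤-trans (top-antitone (ℕ.≤⇒≤′ n<k)) next≤z)

        t≤z : top (node (ℕ.suc n)) ≤ z → t ≤ z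
        t≤z next≤z = proj₂ (proj₂ supremum) (z , hi≤r _) λ (w , w≤r) w∈ →
          let k , w≡ = unresize w∈ in subst (_≤ z) (sym w≡) (pieces≤z next≤z k)

        absurd : ⊥
        -- A caught element has the code of t, so t ≤ z, and the piece of the next node, being at
        -- most t, contradicts `top≰bot`. If none is caught, all pieces and hence t lie below z, so
        -- t is caught after all.
        absurd with em _ {Caught n (node n)} | piece≤t (ℕ.suc n) | t≤z
        ... | yes (w , cw≡n , w≤z) | piece≤t′ | _ =
          top≰bot (lo (hi (hi (node n))))
            (≤-trans piece≤t′ (≤-trans (code-≤ (sym cw≡n)) (≤-trans w≤z (lo-bot _))))
        ... | no ¬caught | _ | t≤z′ = ¬caught (t , refl , t≤z′ (lo≤hi _))

      Family : Set (c ⊔ suc ℓ)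
      Family = ℕ → Pred Carrier ℓ

      Undetected : Family → Pred Carrier ℓ → Set (c ⊔ ℓ₂ ⊔ ℓ)
      Undetected 𝒥 F = ∀ k → ¬ Defect P r F (𝒥 k)

      -- Pairs (a , b) enter through their codes m and n, so that one family can
      -- be chosen for each of countably many pairs.
      Escape : ℕ → ℕ → Family → Set (c ⊔ ℓ₂ ⊔ suc ℓ)
      Escape m n 𝒥 =
        Σ[ F ∈ Pred Carrier ℓ ] Σ[ I ∈ Pred Carrier ℓ ] ∃[ a ] ∃[ b ]
        Defect P r F I × a ∈ F × b ∈ ↓ˢ P I × code a ≡ m × code b ≡ n ×
        Undetected 𝒥 F

      -- Read positively, one countable family detects each filter F that has a defect I, an element
      -- coded m, and an element coded n below a member of I.
      Coverable : ℕ → ℕ → Set (c ⊔ ℓ₂ ⊔ suc ℓ)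
      Coverable m n = Σ[ 𝒥 ∈ Family ] ¬ Escape m n 𝒥

      coverOf : ∀ {m n} → Dec (Coverable m n) → Family
      coverOf (yes (𝒥 , _)) = 𝒥
      -- A placeholder: the empty set is not directed, so it detects nothing.
      coverOf (no  _)       = λ _ _ → Lift ℓ ⊥

      cover : ℕ → ℕ → Family
      cover m n = coverOf (em _ {Coverable m n})

      allCovers : Family
      allCovers k = let m , k′ = unpair k
                        n , l  = unpair k′
                    in cover m n l

      cover⊆allCovers : ∀ m n l → ∃[ k ] allCovers k ≡ cover m n l
      cover⊆allCovers m n l
        with k′ , eq′ ← unpair-surjective n l
        with k , eq ← unpair-surjective m k′
        = k , trans (cong (λ (m , k′) → let n , l = unpair k′ in cover m n l) eq)
                    (cong (λ (n , l) → cover m n l) eq′)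

      -- A cover of the pair would occur inside `allCovers` and detect F.
      undetected⇒¬coverable : ∀ {F I a b} → Defect P r F I → Undetected allCovers F →
        a ∈ F → b ∈ ↓ˢ P I → ¬ Coverable (code a) (code b)
      undetected⇒¬coverable {F} {I} {a} {b} def und a∈F b∈I cov =
        covered (em _) λ l def′ →
          let k , eq = cover⊆allCovers (code a) (code b) l
          in und k (subst (Defect P r F) (sym eq) def′)
        where
        covered : (d : Dec (Coverable (code a) (code b))) →
                  ¬ Undetected (coverOf d) F
        covered (yes (𝒥 , ¬esc)) und =
          ¬esc (F , I , a , b , def , a∈F , b∈I , refl , refl , und)
        covered (no ¬cov) _ = ¬cov cov

      _◂_ : Pred Carrier ℓ → Family → Family
      (I ◂ 𝒥) ℕ.zero    = I
      (I ◂ 𝒥) (ℕ.suc k) = 𝒥 k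

      Node : Set (c ⊔ ℓ₂ ⊔ suc ℓ)
      Node = ∃[ a ] ∃[ b ] ¬ Coverable (code a) (code b)

      top bot : Node → Carrier
      top (a , _)     = a
      bot (_ , b , _) = b

      escape : ∀ ν 𝒥 → Escape (code (top ν)) (code (bot ν)) 𝒥
      escape (_ , _ , ¬cov) 𝒥 = dne λ ¬esc → ¬cov (𝒥 , ¬esc)

      top≰bot : ∀ ν → ¬ top ν ≤ bot ν
      top≰bot ν a≤b
        with F , I , a , b , (filt , _ , _ , _ , disjoint) , a∈F ,
             (i , i∈I , b≤i) , a≡ , b≡ , _ ← escape ν allCovers
        = disjoint (i , i∈I , IsFilter.upper filt
            (≤-trans (code-≤ a≡) (≤-trans a≤b (≤-trans (code-≤ (sym b≡)) b≤i))) a∈F)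

      -- A first escape F yields the pair (a , x); a second escape G, forced to meet I at x, yields
      -- the pair (a′ , b).
      split : ∀ ν → Σ[ λ′ ∈ Node ] Σ[ η ∈ Node ]
        top λ′ ≤ top ν × top η ≤ top ν × bot ν ≤ bot λ′ × bot ν ≤ bot η ×
        top λ′ ≤ bot η × bot η ≤ r
      split ν@(a , b , _)
        with F , I , a₁ , b₁ , def@(filt , dir , (s , sup , s∈F) , I≤r , _) ,
             a₁∈F , b₁∈I , a₁≡ , b₁≡ , und ← escape ν allCovers
        -- Going down to a₀ ≤ s forces every filter containing a₀ to contain s.
        with a₀ , a₀∈F , a₀≤a₁ , a₀≤s ← IsFilter.down filt a₁ s a₁∈F s∈F
        -- With I prepended, G has no defect at I either; as it contains s, it must meet I.
        with G , J , a₂ , b₂ , def′@(filt′ , _) , a₂∈G , b₂∈J , a₂≡ , b₂≡ , und′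
             ← escape (a₀ , b₁ , undetected⇒¬coverable def und a₀∈F b₁∈I)
                      (I ◂ allCovers)
        with x₀ , x₀∈I , x₀∈G ← dne (λ disjoint → und′ 0
               ( filt′ , dir
               , (s , sup , IsFilter.upper filt′ (≤-trans (code-≤ a₂≡) a₀≤s) a₂∈G)
               , I≤r , disjoint))
           | i , i∈I , b₁≤i ← b₁∈I
        with x , x∈I , x₀≤x , i≤x ← proj₂ dir x₀ i x₀∈I i∈I
        with a′ , a′∈G , a′≤a₂ , a′≤x ←
               IsFilter.down filt′ a₂ x a₂∈G (IsFilter.upper filt′ x₀≤x x₀∈G)
        = (a′ , b₂ , undetected⇒¬coverable def′ (und′ ∘ ℕ.suc) a′∈G b₂∈J)
        , (a₁ , x , undetected⇒¬coverable def und a₁∈F (x , x∈I , ≤-refl))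
        , ≤-trans a′≤a₂ (≤-trans (code-≤ a₂≡) (≤-trans a₀≤a₁ (code-≤ a₁≡)))
        , code-≤ a₁≡
        , code-≤ (trans (sym b₁≡) (sym b₂≡))
        , ≤-trans (code-≤ (sym b₁≡)) (≤-trans b₁≤i i≤x)
        , a′≤x
        , I≤r x∈I

      ¬Node : ¬ Node
      ¬Node = noSplittingTree top bot (proj₁ ∘ split) (proj₁ ∘ proj₂ ∘ split) top≰bot
        (λ ν → let _ , _ , p , _ = split ν in p)
        (λ ν → let _ , _ , _ , p , _ = split ν in p)
        (λ ν → let _ , _ , _ , _ , p , _ = split ν in p)
        (λ ν → let _ , _ , _ , _ , _ , p , _ = split ν in p)
        (λ ν → let _ , _ , _ , _ , _ , _ , p , _ = split ν in p)
        (λ ν → let _ , _ , _ , _ , _ , _ , _ , p = split ν in p)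

      -- An undetected defect would make a node of the supremum of I paired with any member of I.
      detect : ∀ {F I} → Defect P r F I → ∃[ k ] Defect P r F (allCovers k)
      detect def@(_ , ((i , i∈I) , _) , (s , _ , s∈F) , _) = dne λ und →
        ¬Node (s , i , undetected⇒¬coverable def (λ k d → und (k , d)) s∈F
          (i , i∈I , ≤-refl))

  -- Products: coordinatewise suprema and boxes.

  module Product {c ℓ₁ ℓ₂ : Level} (ℓ : Level) {n : ℕ}
                 (P : Fin n → Poset c ℓ₁ ℓ₂) where

    open module Pᵢ {i} = Poset (P i) using () renaming
      (_≤_ to _≤ᵢ_; refl to ≤ᵢ-refl; trans to ≤ᵢ-trans; reflexive to ≤ᵢ-reflexive)
    open Poset (ΠPoset P) using (_≤_) renaming
      (Carrier to Point; refl to ≤-refl; trans to ≤-trans)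

    -- Replacing coordinate i of s by an upper bound u of the projection gives an upper bound of D,
    -- so s lies below it.
    isSup-coordinate : ∀ {D : Pred Point ℓ} {s} → IsSup (ΠPoset P) D s → ∀ i →
      IsSup (P i) (λ y → Resize ℓ (∃[ d ] d ∈ D × d i ≡ y)) (s i)
    isSup-coordinate {D} {s} (upper , least) i =
      (λ y y∈ → let d , d∈D , d≡y = unresize y∈
                in subst (_≤ᵢ s i) d≡y (upper d d∈D i)) ,
      λ u ub → ≔-diagonal s i (s i ≤ᵢ_) (least (s [ i ≔ u ])
        (λ d d∈D → ≔-elim (λ j y → d j ≤ᵢ y) s i
          (ub (d i) (resize (d , d∈D , refl))) (upper d d∈D))
        i)

    ΠTop⊆σ : ΠTop (λ i → σ (P i) ℓ) ⊆ σ (ΠPoset P) ℓ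
    ΠTop⊆σ {U} open-U = upper , meets
      where
      upper : U Respects _≤_
      upper {x} {y} x≤y x∈U with V , V-open , x∈V , V⊆U ← open-U x x∈U =
        V⊆U λ i → proj₁ (V-open i) (x≤y i) (x∈V i)

      meets : ∀ (D : Pred Point ℓ) → Directed (ΠPoset P) D →
              ∀ s → IsSup (ΠPoset P) D s → s ∈ U → D ≬ U
      meets D dir@((d₀ , d₀∈D) , join) s sup s∈U
        with V , V-open , s∈V , V⊆U ← open-U s s∈U
        = let u , u∈D , f≤u = directed⇒finiteBound (ΠPoset P) dir
                (λ i → proj₁ (hit i)) (λ i → proj₁ (proj₂ (hit i)))
          in u , u∈D , V⊆U λ i →
               proj₁ (V-open i) (f≤u i i) (proj₂ (proj₂ (hit i)))
        where
        hit : ∀ i → ∃[ d ] d ∈ D × d i ∈ V i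
        hit i
          with y , y∈ , y∈V ← proj₂ (V-open i)
                 (λ y → Resize ℓ (∃[ d ] d ∈ D × d i ≡ y))
                 ( (d₀ i , resize (d₀ , d₀∈D , refl))
                 , λ y z y∈ z∈ →
                     let d , d∈D , d≡y = unresize y∈
                         e , e∈D , e≡z = unresize z∈
                         u , u∈D , d≤u , e≤u = join d e d∈D e∈D
                     in u i , resize (u , u∈D , refl)
                        , subst (_≤ᵢ u i) d≡y (d≤u i)
                        , subst (_≤ᵢ u i) e≡z (e≤u i))
                 (s i) (isSup-coordinate sup i) (s∈V i)
          with d , d∈D , refl ← unresize y∈
          = d , d∈D , y∈V

    module _ {E : ∀ i → Pred (Poset.Carrier (P i)) ℓ}
             (dir : ∀ i → Directed (P i) (E i)) where

      box-directed : Directed (ΠPoset P) (Box E)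
      box-directed =
        ((λ i → proj₁ (proj₁ (dir i))) , λ i → proj₂ (proj₁ (dir i))) ,
        λ x y x∈ y∈ →
          let bound = λ i → proj₂ (dir i) (x i) (y i) (x∈ i) (y∈ i)
          in (λ i → proj₁ (bound i)) , (λ i → proj₁ (proj₂ (bound i))) ,
             (λ i → proj₁ (proj₂ (proj₂ (bound i)))) ,
             (λ i → proj₂ (proj₂ (proj₂ (bound i))))

      -- Each y in `E i` is a coordinate of a point of the box: the other coordinates come from a
      -- fixed point e.
      box-isSup : ∀ {p} → (∀ i → IsSup (P i) (E i) (p i)) →
                  IsSup (ΠPoset P) (Box E) p
      box-isSup sup =
        (λ x x∈ i → proj₁ (sup i) (x i) (x∈ i)) ,
        λ u ub i → proj₂ (sup i) (u i) λ y y∈ →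
          let e , e∈ = proj₁ box-directed
          in ≔-diagonal e i (_≤ᵢ u i)
               (ub (e [ i ≔ y ]) (≔-elim (λ j → _∈ E j) e i y∈ e∈) i)

    -- Descending sequences and the filters they generate.

    record Descent (U : Pred Point ℓ) (x : Point)
                   (J : ∀ i → ℕ → Pred (Poset.Carrier (P i)) ℓ) :
                   Set (c ⊔ ℓ₂ ⊔ ℓ) where
      field
        p      : ℕ → Point
        start  : p 0 ≡ x
        inside : ∀ k → p k ∈ U
        step   : ∀ k → p (ℕ.suc k) ≤ p k
        -- Every index is treated at infinitely many stages, since the supremum
        -- of J i j may enter the filter generated by the p k i late.
        treat  : ∀ k i → let j = proj₁ (unpair k) in
                 Dominates (P i) (J i j) (p k i) →
                 p (ℕ.suc k) i ∈ ↓ˢ (P i) (J i j)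

      antitone : ∀ {k m} → k ℕ.≤ m → p m ≤ p k
      antitone k≤m = steps⇒monotone {R = flip _≤_} ≤-refl (flip ≤-trans) p step
        (ℕ.≤⇒≤′ k≤m)

    module _ (mc : ∀ i → MeetContinuous (P i) ℓ)
             (sups : ∀ i → PrincipalIdealsHaveSups (P i) ℓ)
             {U : Pred Point ℓ} (U-open : U ∈ σ (ΠPoset P) ℓ) where

      -- The box of the refined sets is directed with supremum p, so the open set U contains a point
      -- of it; this treats all coordinates at once.
      lowering : ∀ (J : ∀ i → Pred (Poset.Carrier (P i)) ℓ) p → p ∈ U →
        ∃[ q ] q ∈ U × q ≤ p ×
        (∀ i → Dominates (P i) (J i) (p i) → q i ∈ ↓ˢ (P i) (J i))
      lowering J p p∈U =
        let E    = λ i → Factor.refine ℓ (P i) (mc i) (sups i) (J i) (p i)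
            dir  = λ i → proj₁ (proj₂ (E i))
            sup  = λ i → proj₁ (proj₂ (proj₂ (E i)))
            q , q∈E , q∈U = proj₂ U-open (Box (λ i → proj₁ (E i)))
              (box-directed dir) p (box-isSup dir sup) p∈U
        in q , q∈U , (λ i → proj₁ (sup i) (q i) (q∈E i)) ,
           λ i dom → proj₂ (proj₂ (proj₂ (E i))) dom (q∈E i)

      descent : ∀ {x} → x ∈ U → ∀ J → Descent U x J
      descent {x} x∈U J = record
        { p      = proj₁ ∘ stage
        ; start  = refl
        ; inside = proj₂ ∘ stage
        ; step   = λ k → proj₁ (proj₂ (proj₂ (next k (stage k))))
        ; treat  = λ k → proj₂ (proj₂ (proj₂ (next k (stage k))))
        }
        where
        next : ∀ k ((p , _) : Σ[ p ∈ Point ] p ∈ U) → _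
        next k (p , p∈U) = lowering (λ i → J i (proj₁ (unpair k))) p p∈U

        stage : ℕ → Σ[ p ∈ Point ] p ∈ U
        stage ℕ.zero    = x , x∈U
        stage (ℕ.suc k) = let q , q∈U , _ = next k (stage k) in q , q∈U

    module _ (mc : ∀ i → MeetContinuous (P i) ℓ)
             (sups : ∀ i → PrincipalIdealsHaveSups (P i) ℓ)
             {U : Pred Point ℓ} (U-upper : U Respects _≤_) {x : Point}
             {J : ∀ i → ℕ → Pred (Poset.Carrier (P i)) ℓ}
             (detect : ∀ i {F I} → Defect (P i) (x i) F I →
                       ∃[ k ] Defect (P i) (x i) F (J i k))
             (generic : Descent U x J) where

      open Descent generic

      V : ∀ i → Pred (Poset.Carrier (P i)) ℓ
      V i y = Resize ℓ (∃[ k ] p k i ≤ᵢ y)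

      V-isFilter : ∀ i → IsFilter (P i) (V i)
      V-isFilter i = record
        { upper = λ y≤z y∈ → let k , pk≤y = unresize y∈
                             in resize (k , ≤ᵢ-trans pk≤y y≤z)
        ; down  = λ y z y∈ z∈ →
            let k , pk≤y = unresize y∈
                m , pm≤z = unresize z∈
            in p (k ℕ.⊔ m) i , resize (k ℕ.⊔ m , ≤ᵢ-refl)
               , ≤ᵢ-trans (antitone (ℕ.m≤m⊔n k m) i) pk≤y
               , ≤ᵢ-trans (antitone (ℕ.m≤n⊔m k m) i) pm≤z
        }

      -- If s is in the filter from stage m on, the stage l coding `(k , m)` has l ≥ m, so its point
      -- is dominated by `J i k` and the next point falls below a member of it.
      noDefect : ∀ i k → ¬ Defect (P i) (x i) (V i) (J i k)
      noDefect i k (_ , dir , (s , sup , s∈V) , _ , disjoint)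
        with m , pm≤s ← unresize s∈V
        with l , eq ← unpair-surjective k m
        = let y , y∈J , p≤y = hit in disjoint (y , y∈J , resize (ℕ.suc l , p≤y))
        where
        m≤l : m ℕ.≤ l
        m≤l = ℕ.≤-trans (ℕ.m≤n+m m k)
          (subst (λ (a , b) → a ℕ.+ b ℕ.≤ l) eq (unpair-sum-≤ l))

        hit : p (ℕ.suc l) i ∈ ↓ˢ (P i) (J i k)
        hit = subst (λ (j , _) → Dominates (P i) (J i j) (p l i) →
                                 p (ℕ.suc l) i ∈ ↓ˢ (P i) (J i j)) eq
          (treat l i) (dir , s , sup , ≤ᵢ-trans (antitone m≤l i) pm≤s)

      -- A failure at D persists for the part of the down-set of D below `p k i`, which has supremum
      -- `p k i` and is bounded by `x i`, hence is a defect.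
      V-open : ∀ i → V i ∈ σ (P i) ℓ
      V-open i = IsFilter.upper (V-isFilter i) , λ D dir s sup s∈V →
        dne λ disjoint →
          let k , pk≤s = unresize s∈V
              l , def = detect i {F = V i} {I = Factor.below ℓ (P i) (p k i) D}
                ( V-isFilter i
                , Factor.below-directed ℓ (P i) (mc i) (sups i) dir sup pk≤s
                , ( p k i
                  , Factor.below-isSup ℓ (P i) (mc i) (sups i) dir sup pk≤s
                  , resize (k , ≤ᵢ-refl))
                , (λ y∈ → ≤ᵢ-trans (proj₁ (unresize y∈))
                    (subst (λ x → p k i ≤ᵢ x i) start (antitone ℕ.z≤n i)))
                , λ (y , y∈ , y∈V) →
                    let _ , d , d∈D , y≤d = unresize y∈
                    in disjoint (d , d∈D , IsFilter.upper (V-isFilter i) y≤d y∈V))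
          in noDefect i l def

      V⊆U : Box V ⊆ U
      V⊆U {y} y∈V =
        let index = λ i → unresize (y∈V i)
            -- `λ _ → ℕ` stands for the full subset of the naturals, each membership proved by 0.
            m , _ , k≤m = directed⇒finiteBound ℕ.≤-poset {D = λ _ → ℕ}
              ((0 , 0) , λ k m _ _ → k ℕ.⊔ m , 0 , ℕ.m≤m⊔n k m , ℕ.m≤n⊔m k m)
              (λ i → proj₁ (index i)) (λ _ → 0)
        in U-upper (λ i → ≤ᵢ-trans (antitone (k≤m i) i) (proj₂ (index i))) (inside m)

      x∈V : x ∈ Box V
      x∈V i = resize (0 , subst (λ x → p 0 i ≤ᵢ x i) start ≤ᵢ-refl)

    σ⊆ΠTop : (∀ i → Countable (P i)) → (∀ i → MeetContinuous (P i) ℓ) →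
             (∀ i → PrincipalIdealsHaveSups (P i) ℓ) →
             σ (ΠPoset P) ℓ ⊆ ΠTop (λ i → σ (P i) ℓ)
    σ⊆ΠTop countable mc sups {U} U-open x x∈U =
      V mc sups upper detect generic , V-open mc sups upper detect generic ,
      x∈V mc sups upper detect generic , V⊆U mc sups upper detect generic
      where
      upper = proj₁ U-open

      J : ∀ i → ℕ → Pred (Poset.Carrier (P i)) ℓ
      J i = Factor.allCovers ℓ (P i) (countable i) (sups i) (x i)

      detect : ∀ i {F I} → Defect (P i) (x i) F I →
               ∃[ k ] Defect (P i) (x i) F (J i k)
      detect i = Factor.detect ℓ (P i) (countable i) (sups i) (x i)

      generic : Descent U x J
      generic = descent mc sups {U} U-open x∈U J

corollary4p2 : (∀ a → ExcludedMiddle a) →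
    ∀ {c ℓ₁ ℓ₂ : Level} (ℓ : Level) (n : ℕ) (P : Fin n → Poset c ℓ₁ ℓ₂) →
    (∀ i → IsDCPO (P i) ℓ) →
    (∀ i → Countable (P i)) →
    (∀ i → MeetContinuous (P i) ℓ) →
    (∀ i → PrincipalIdealsHaveSups (P i) ℓ) →
    σ (ΠPoset P) ℓ ≐ ΠTop (λ i → σ (P i) ℓ)
corollary4p2 em ℓ n P _ countable mc sups =
  Product.σ⊆ΠTop em ℓ P countable mc sups ,
  Product.ΠTop⊆σ em ℓ P
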